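{- Any $n$-vertex graph admits a voxel representation of size $O(n^2)$. That is, there is an absolute constant $C>0$ such that for every integer $n\ge 1$, every graph with $n$ vertices has a voxel representation of size at most $C\,n^2$.
   Context: All graphs are finite and simple. A voxel is a cell of the unit cube grid in 3-dimensional space; two distinct voxels are adjacent if they share a face. A blob is a nonempty finite set of voxels that is connected with respect to this adjacency. A voxel representation of a graph $G=(V,E)$ assigns to each vertex $v\in V$ a blob $B_v$ such that the blobs of distinct vertices are disjoint and, for all distinct $u,v\in V$, some voxel of $B_u$ is adjacent to some voxel of $B_v$ if and only if $uv\in E$. Its size is $\sum_{v\in V}|B_v|$. -}

module Defs where

open import Data.Fin using (Fin)
open import Data.Integer as ℤ using (ℤ)
open import Data.List using (List; []; length; tabulate)
open import Data.List.Membership.Propositional using (_∈_)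
open import Data.List.Relation.Binary.Disjoint.Propositional using (Disjoint)
open import Data.List.Relation.Unary.Unique.Propositional using (Unique)
open import Data.Nat using (ℕ)
open import Data.Nat.ListAction using (sum)
open import Data.Product using (_×_; _,_; ∃-syntax)
open import Data.Vec using (Vec; _[_]%=_)
open import Function.Bundles using (_⇔_)
open import Level using (0ℓ)
open import Relation.Binary.Construct.Closure.ReflexiveTransitive using (Star)
open import Relation.Binary.Core using (Rel)
open import Relation.Binary.Definitions using (Decidable; Irreflexive; Symmetric)
open import Relation.Binary.PropositionalEquality using (_≡_; _≢_)

-- Decidability of the edge relation is automatic classically; constructively
-- it says that the graph is given as a finite object.
record Graph (n : ℕ) : Set₁ where
  field
    Edge   : Rel (Fin n) 0ℓ
    edge?  : Decidable Edge
    sym    : Symmetric Edge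
    irrefl : Irreflexive _≡_ Edge

Axis : Set
Axis = Fin 3

-- The voxel (x, y, z) is the cell [x, x+1] × [y, y+1] × [z, z+1].
Voxel : Set
Voxel = Vec ℤ 3

step : Axis → Voxel → Voxel
step a v = v [ a ]%= ℤ.suc

-- (a , p) is the unit grid square orthogonal to the axis a whose
-- coordinatewise least corner is the lattice point p.
Face : Set
Face = Axis × Vec ℤ 3

data _IsFaceOf_ : Face → Voxel → Set where
  lower : ∀ a v → (a , v) IsFaceOf v
  upper : ∀ a v → (a , step a v) IsFaceOf v

Adjacent : Rel Voxel 0ℓ
Adjacent u v = u ≢ v × ∃[ f ] (f IsFaceOf u × f IsFaceOf v)

AdjacentIn : List Voxel → Rel Voxel 0ℓ
AdjacentIn B u v = u ∈ B × v ∈ B × Adjacent u v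

Connected : List Voxel → Set
Connected B = ∀ {u v} → u ∈ B → v ∈ B → Star (AdjacentIn B) u v

-- A finite set of voxels is listed without repetition, so that its
-- cardinality is the length of the list.
record Blob : Set where
  field
    voxels    : List Voxel
    unique    : Unique voxels
    nonempty  : voxels ≢ []
    connected : Connected voxels

open Blob public using (voxels)

∣_∣ᵇ : Blob → ℕ
∣ B ∣ᵇ = length (voxels B)

Touching : Rel Blob 0ℓ
Touching B B′ = ∃[ p ] ∃[ q ] (p ∈ voxels B × q ∈ voxels B′ × Adjacent p q)

record VoxelRepresentation {n : ℕ} (G : Graph n) : Set where
  open Graph G using (Edge)
  field
    blob     : Fin n → Blob
    disjoint : ∀ {u v} → u ≢ v → Disjoint (voxels (blob u)) (voxels (blob v))
    contact  : ∀ {u v} → u ≢ v → Touching (blob u) (blob v) ⇔ Edge u v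

  size : ℕ
  size = sum (tabulate (λ v → ∣ blob v ∣ᵇ))

open VoxelRepresentation public using (size)

{-# OPTIONS --safe #-}
-- Vertex v gets a bar parallel to the x-axis at (·, 2v, 0), a bar parallel to
-- the y-axis at (2v, ·, 2), and, in the layer between, a peg at (2w, 2v, 1) for
-- w = v and for every neighbour w of v.  The peg at (2w, 2v, 1) sits on the
-- lower bar of v and touches the upper bar of w, so the pegs join the two bars
-- of v and realise exactly the contacts along the edges; the spacing 2 rules
-- out all others.  A blob has at most 2n + 2n + n voxels.
module Submission where

open import Defs
open import Data.Fin using (Fin; zero; suc; toℕ)
open import Data.Fin.Properties as Fin using (toℕ-injective; toℕ<n)
open import Data.Integer as ℤ using (+_)
open import Data.Integer.Properties using (i≢suc[i]; pred-suc)
open import Data.List using (List; _++_; allFin; filter; length; map; tabulate; upTo)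
open import Data.List.Membership.Propositional using (_∈_)
open import Data.List.Membership.Propositional.Properties
  using (∈-++⁺ˡ; ∈-++⁺ʳ; ∈-++⁻; ∈-allFin; ∈-filter⁺; ∈-filter⁻; ∈-map⁺; ∈-map⁻; ∈-upTo⁺; ∈-upTo⁻)
open import Data.List.Properties using (length-++; length-filter; length-map; length-tabulate; length-upTo)
open import Data.List.Relation.Binary.Disjoint.Propositional using (Disjoint)
open import Data.List.Relation.Unary.Any.Properties using (¬Any[])
open import Data.List.Relation.Unary.Unique.Propositional using (Unique)
import Data.List.Relation.Unary.Unique.Propositional.Properties as Unique
open import Data.Nat using (ℕ; zero; suc; _+_; _*_; _^_; _<_; _≤_; _>_; _≥_; z≤n; s≤s)
open import Data.Nat.ListAction using (sum)
open import Data.Nat.Properties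
  using (*-cancelˡ-≡; *-monoʳ-<; +-mono-≤; +-monoʳ-≤; <-trans; even≢odd; module ≤-Reasoning; n<1+n)
open import Data.Nat.Tactic.RingSolver using (solve-∀)
open import Data.Product using (_×_; _,_; proj₁; proj₂; ∃-syntax; Σ-syntax)
open import Data.Sum using (_⊎_; inj₁; inj₂)
open import Data.Vec using ([]; _∷_; lookup; _[_]%=_)
open import Data.Vec.Properties using (lookup∘updateAt; updateAt-id-local; updateAt-updateAt)
open import Function using (_∘_)
open import Function.Bundles using (mk⇔)
open import Relation.Binary.Construct.Closure.ReflexiveTransitive using (Star; ε; _◅_; _◅◅_; reverse)
open import Relation.Binary.Definitions using (Symmetric)
open import Relation.Binary.PropositionalEquality
  using (_≡_; _≢_; refl; sym; trans; cong; cong₂; subst; ≢-sym)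
open import Relation.Nullary using (Dec; contradiction)
open import Relation.Nullary.Decidable using (_⊎-dec_)

-- Face adjacency as a unit step along an axis.

step-injective : ∀ a {p q} → step a p ≡ step a q → p ≡ q
step-injective a {p} {q} eq =
  trans (sym (unstep p)) (trans (cong (_[ a ]%= ℤ.pred) eq) (unstep q))
  where
  unstep : ∀ p → step a p [ a ]%= ℤ.pred ≡ p
  unstep p = trans (updateAt-updateAt a p) (updateAt-id-local a p (pred-suc _))

p≢step : ∀ a p → p ≢ step a p
p≢step a p eq =
  i≢suc[i] (trans (cong (λ v → lookup v a) eq) (lookup∘updateAt a p))

adjacent-sym : Symmetric Adjacent
adjacent-sym (p≢q , f , f-p , f-q) = ≢-sym p≢q , f , f-q , f-p

step⇒adjacent : ∀ a p → Adjacent p (step a p)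
step⇒adjacent a p = p≢step a p , (a , step a p) , upper a p , lower a (step a p)

face-side : ∀ {f p} → f IsFaceOf p → proj₂ f ≡ p ⊎ proj₂ f ≡ step (proj₁ f) p
face-side (lower _ _) = inj₁ refl
face-side (upper _ _) = inj₂ refl

-- The shared face is the lower or the upper one of each voxel. On the same side of both it would
-- force `p ≡ q`, so it is the upper face of one and the lower face of the other.
adjacent⇒step : ∀ {p q} → Adjacent p q → ∃[ a ] (q ≡ step a p ⊎ p ≡ step a q)
adjacent⇒step (p≢q , (a , _) , f-p , f-q) with face-side f-p | face-side f-q
... | inj₁ refl | inj₁ eq = contradiction eq p≢q
... | inj₁ refl | inj₂ eq = a , inj₂ eq
... | inj₂ refl | inj₁ eq = a , inj₁ (sym eq)
... | inj₂ refl | inj₂ eq = contradiction (step-injective a eq) p≢q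

-- Paths inside a blob.

adjacentIn-sym : ∀ {B} → Symmetric (AdjacentIn B)
adjacentIn-sym (p∈B , q∈B , p~q) = q∈B , p∈B , adjacent-sym p~q

connected-via : ∀ {B} r → (∀ {p} → p ∈ B → Star (AdjacentIn B) p r) → Connected B
connected-via r p⇝r p∈B q∈B = p⇝r p∈B ◅◅ reverse adjacentIn-sym (p⇝r q∈B)

segment-connected : ∀ {B m} a (f : ℕ → Voxel) → (∀ i → f (suc i) ≡ step a (f i)) →
                    (∀ {i} → i < m → f i ∈ B) →
                    ∀ {i} → i < m → Star (AdjacentIn B) (f i) (f 0)
segment-connected a f f-suc f∈B {zero}  _    = ε
segment-connected a f f-suc f∈B {suc i} si<m =
  (f∈B si<m , f∈B i<m , adjacent-sym (subst (Adjacent (f i)) (sym (f-suc i)) (step⇒adjacent a (f i))))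
  ◅ segment-connected a f f-suc f∈B i<m
  where i<m = <-trans (n<1+n i) si<m

-- Even coordinates in the nonnegative octant.

voxel : ℕ → ℕ → ℕ → Voxel
voxel x y z = + x ∷ + y ∷ + z ∷ []

coordinates : ∀ {x y z x′ y′ z′} → voxel x y z ≡ voxel x′ y′ z′ → x ≡ x′ × y ≡ y′ × z ≡ z′
coordinates refl = refl , refl , refl

double : ∀ {n} → Fin n → ℕ
double i = 2 * toℕ i

double-injective : ∀ {n} {i j : Fin n} → double i ≡ double j → i ≡ j
double-injective {i = i} {j} = toℕ-injective ∘ *-cancelˡ-≡ (toℕ i) (toℕ j) 2

double< : ∀ {n} (i : Fin n) → double i < 2 * n
double< i = *-monoʳ-< 2 (toℕ<n i)

sum-tabulate-≤ : ∀ {n c} (f : Fin n → ℕ) → (∀ i → f i ≤ c) → sum (tabulate f) ≤ n * c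
sum-tabulate-≤ {zero}  f f≤c = z≤n
sum-tabulate-≤ {suc n} f f≤c = +-mono-≤ (f≤c zero) (sum-tabulate-≤ (f ∘ suc) (f≤c ∘ suc))

module Construction {n : ℕ} (G : Graph n) where
  open Graph G renaming (sym to edge-sym)

  -- The reflexive closure of `Edge`: the diagonal supplies the peg that joins the two bars of `v`.
  Near : Fin n → Fin n → Set
  Near v w = v ≡ w ⊎ Edge v w

  near? : ∀ v w → Dec (Near v w)
  near? v w = (v Fin.≟ w) ⊎-dec edge? v w

  -- Indexes the voxels of the blob of `v` by kind, so that geometric arguments become case analyses
  -- instead of list reasoning. The subscript of a bar is its layer.
  data Part (v : Fin n) : Set where
    bar₀ : ∀ {x} → x < 2 * n → Part v
    bar₂ : ∀ {y} → y < 2 * n → Part v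
    peg  : ∀ {w} → Near v w → Part v

  position : ∀ {v} → Part v → Voxel
  position {v} (bar₀ {x} _) = voxel x (double v) 0
  position {v} (bar₂ {y} _) = voxel (double v) y 2
  position {v} (peg  {w} _) = voxel (double w) (double v) 1

  -- Different kinds lie in different layers, and within each layer one fixed coordinate is the
  -- double of the owner.
  position-owner : ∀ {u v} (p : Part u) (q : Part v) → position p ≡ position q → u ≡ v
  position-owner (bar₀ _) (bar₀ _) eq = double-injective (proj₁ (proj₂ (coordinates eq)))
  position-owner (bar₂ _) (bar₂ _) eq = double-injective (proj₁ (coordinates eq))
  position-owner (peg _)  (peg _)  eq = double-injective (proj₁ (proj₂ (coordinates eq)))

  -- The omitted combinations are refuted by the z-coordinates alone.
  position-step : ∀ {u v} (p : Part u) (q : Part v) a → position q ≡ step a (position p) → Near u v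
  position-step (bar₀ _) (bar₀ _) zero eq =
    inj₁ (sym (double-injective (proj₁ (proj₂ (coordinates eq)))))
  -- Parallel bars differ by an even offset, never by a single step.
  position-step {u} {v} (bar₀ _) (bar₀ _) (suc zero) eq =
    contradiction (proj₁ (proj₂ (coordinates eq))) (even≢odd (toℕ v) (toℕ u))
  position-step (bar₀ _) (peg _) (suc (suc zero)) eq =
    inj₁ (sym (double-injective (proj₁ (proj₂ (coordinates eq)))))
  position-step (peg {w} _) (peg {w′} _) zero eq =
    contradiction (proj₁ (coordinates eq)) (even≢odd (toℕ w′) (toℕ w))
  position-step {u} {v} (peg _) (peg _) (suc zero) eq =
    contradiction (proj₁ (proj₂ (coordinates eq))) (even≢odd (toℕ v) (toℕ u))
  -- The only case where distinct owners can meet: the upper bar above a peg belongs to the `w` of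
  -- that peg.
  position-step {u} (peg u~w) (bar₂ _) (suc (suc zero)) eq =
    subst (Near u) (sym (double-injective (proj₁ (coordinates eq)))) u~w
  position-step {u} {v} (bar₂ _) (bar₂ _) zero eq =
    contradiction (proj₁ (coordinates eq)) (even≢odd (toℕ v) (toℕ u))
  position-step (bar₂ _) (bar₂ _) (suc zero) eq =
    inj₁ (sym (double-injective (proj₁ (coordinates eq))))
  position-step (bar₂ _) (bar₂ _) (suc (suc zero)) ()

  -- Voxel lists: membership, uniqueness and connectedness.

  bar₀-voxels bar₂-voxels peg-voxels blob-voxels : Fin n → List Voxel
  bar₀-voxels v = map (λ x → voxel x (double v) 0) (upTo (2 * n))
  bar₂-voxels v = map (λ y → voxel (double v) y 2) (upTo (2 * n))
  peg-voxels  v = map (λ w → voxel (double w) (double v) 1) (filter (near? v) (allFin n))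
  blob-voxels v = bar₀-voxels v ++ bar₂-voxels v ++ peg-voxels v

  position∈ : ∀ {v} (p : Part v) → position p ∈ blob-voxels v
  position∈ {v} (bar₀ x<2n) = ∈-++⁺ˡ (∈-map⁺ _ (∈-upTo⁺ x<2n))
  position∈ {v} (bar₂ y<2n) = ∈-++⁺ʳ (bar₀-voxels v) (∈-++⁺ˡ (∈-map⁺ _ (∈-upTo⁺ y<2n)))
  position∈ {v} (peg {w} v~w) =
    ∈-++⁺ʳ (bar₀-voxels v) (∈-++⁺ʳ (bar₂-voxels v) (∈-map⁺ _ (∈-filter⁺ (near? v) (∈-allFin w) v~w)))

  part : ∀ v {p} → p ∈ blob-voxels v → Σ[ q ∈ Part v ] (p ≡ position q)
  part v p∈ with ∈-++⁻ (bar₀-voxels v) p∈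
  ... | inj₁ p∈₀ with _ , x∈ , refl ← ∈-map⁻ _ p∈₀ = bar₀ (∈-upTo⁻ x∈) , refl
  ... | inj₂ p∈′ with ∈-++⁻ (bar₂-voxels v) p∈′
  ...   | inj₁ p∈₂ with _ , y∈ , refl ← ∈-map⁻ _ p∈₂ = bar₂ (∈-upTo⁻ y∈) , refl
  ...   | inj₂ p∈₁ with _ , w∈ , refl ← ∈-map⁻ _ p∈₁ =
    peg (proj₂ (∈-filter⁻ (near? v) {xs = allFin n} w∈)) , refl

  -- Each of the three lists is an injective image of a repetition-free list, and their
  -- z-coordinates 0, 2 and 1 keep them apart.
  blob-unique : ∀ v → Unique (blob-voxels v)
  blob-unique v = Unique.++⁺ unique₀ (Unique.++⁺ unique₂ unique₁ disjoint₂₁) disjoint₀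
    where
    unique₀ : Unique (bar₀-voxels v)
    unique₀ = Unique.map⁺ (proj₁ ∘ coordinates) (Unique.upTo⁺ (2 * n))

    unique₂ : Unique (bar₂-voxels v)
    unique₂ = Unique.map⁺ (proj₁ ∘ proj₂ ∘ coordinates) (Unique.upTo⁺ (2 * n))

    unique₁ : Unique (peg-voxels v)
    unique₁ = Unique.map⁺ (double-injective ∘ proj₁ ∘ coordinates) (Unique.filter⁺ (near? v) (Unique.allFin⁺ n))

    disjoint₂₁ : Disjoint (bar₂-voxels v) (peg-voxels v)
    disjoint₂₁ (p∈₂ , p∈₁) with _ , _ , refl ← ∈-map⁻ _ p∈₂ | _ , _ , eq ← ∈-map⁻ _ p∈₁
      with _ , _ , () ← coordinates eq

    disjoint₀ : Disjoint (bar₀-voxels v) (bar₂-voxels v ++ peg-voxels v)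
    disjoint₀ (p∈₀ , p∈′) with ∈-map⁻ _ p∈₀ | ∈-++⁻ (bar₂-voxels v) p∈′
    ... | _ , _ , refl | inj₁ p∈₂ with _ , _ , eq ← ∈-map⁻ _ p∈₂ with _ , _ , () ← coordinates eq
    ... | _ , _ , refl | inj₂ p∈₁ with _ , _ , eq ← ∈-map⁻ _ p∈₁ with _ , _ , () ← coordinates eq

  blob-connected : ∀ v → Connected (blob-voxels v)
  blob-connected v = connected-via (voxel 0 (double v) 0) (to-root ∘ part v)
    where
    _⇝_ : Voxel → Voxel → Set
    _⇝_ = Star (AdjacentIn (blob-voxels v))

    along₀ : ∀ {x} → x < 2 * n → voxel x (double v) 0 ⇝ voxel 0 (double v) 0
    along₀ = segment-connected zero _ (λ _ → refl) (position∈ ∘ bar₀)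

    along₂ : ∀ {y} → y < 2 * n → voxel (double v) y 2 ⇝ voxel (double v) 0 2
    along₂ = segment-connected (suc zero) _ (λ _ → refl) (position∈ ∘ bar₂)

    from-peg : ∀ {w} → Near v w → voxel (double w) (double v) 1 ⇝ voxel 0 (double v) 0
    from-peg {w} v~w =
      -- The lower bar has length `2 * n`, so it reaches below every peg of `v`.
      (position∈ (peg v~w) , position∈ (bar₀ (double< w)) , adjacent-sym (step⇒adjacent (suc (suc zero)) _))
      ◅ along₀ (double< w)

    to-root : ∀ {p} → Σ[ q ∈ Part v ] (p ≡ position q) → p ⇝ voxel 0 (double v) 0
    to-root (bar₀ x<2n , refl) = along₀ x<2n
    to-root (peg v~w   , refl) = from-peg v~w
    to-root (bar₂ y<2n , refl) =
      -- The path runs to the end `y = 0` of the upper bar, back out to `double v`, and down through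
      -- the diagonal peg.
      along₂ y<2n ◅◅ reverse adjacentIn-sym (along₂ (double< v)) ◅◅
      (position∈ (bar₂ (double< v)) , position∈ (peg (inj₁ refl)) ,
        adjacent-sym (step⇒adjacent (suc (suc zero)) _))
      ◅ from-peg (inj₁ refl)

  vertex-blob : Fin n → Blob
  vertex-blob v = record
    { voxels    = blob-voxels v
    ; unique    = blob-unique v
    ; nonempty  = λ empty → ¬Any[] (subst (_ ∈_) empty (position∈ {v} (peg (inj₁ refl))))
    ; connected = blob-connected v
    }

  touching⇒near : ∀ {u v} → Touching (vertex-blob u) (vertex-blob v) → Near u v
  touching⇒near {u} {v} (_ , _ , p∈ , q∈ , p~q)
    with part u p∈ | part v q∈ | adjacent⇒step p~q
  ... | p , refl | q , refl | a , inj₁ eq = position-step p q a eq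
  -- `position-step` covers steps from the first blob to the second; the opposite direction follows
  -- by symmetry of `Near`.
  ... | p , refl | q , refl | a , inj₂ eq with position-step q p a eq
  ...   | inj₁ v≡u = inj₁ (sym v≡u)
  ...   | inj₂ v~u = inj₂ (edge-sym v~u)

  -- The peg of `u` for its neighbour `v` lies at `(2v, 2u, 1)`, directly below the voxel
  -- `(2v, 2u, 2)` of the upper bar of `v`.
  edge⇒touching : ∀ {u v} → Edge u v → Touching (vertex-blob u) (vertex-blob v)
  edge⇒touching {u} {v} u~v =
    _ , _ , position∈ (peg (inj₂ u~v)) , position∈ (bar₂ (double< u)) , step⇒adjacent (suc (suc zero)) _

  representation : VoxelRepresentation G
  representation = record
    { blob     = vertex-blob
    ; disjoint = λ {u} {v} u≢v (p∈u , p∈v) → u≢v (same-owner (part u p∈u) (part v p∈v))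
    ; contact  = λ u≢v → mk⇔ (near⇒edge u≢v ∘ touching⇒near) edge⇒touching
    }
    where
    same-owner : ∀ {u v r} → Σ[ p ∈ Part u ] (r ≡ position p) → Σ[ q ∈ Part v ] (r ≡ position q) → u ≡ v
    same-owner (p , refl) (q , eq) = position-owner p q eq

    near⇒edge : ∀ {u v} → u ≢ v → Near u v → Edge u v
    near⇒edge u≢v (inj₁ u≡v) = contradiction u≡v u≢v
    near⇒edge u≢v (inj₂ u~v) = u~v

  -- Counting voxels.

  blob-size : ∀ v → ∣ vertex-blob v ∣ᵇ ≤ 5 * n
  blob-size v = begin
    length (blob-voxels v)
      ≡⟨ trans (length-++ (bar₀-voxels v)) (cong (λ k → length (bar₀-voxels v) + k) (length-++ (bar₂-voxels v))) ⟩
    length (bar₀-voxels v) + (length (bar₂-voxels v) + length (peg-voxels v))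
      ≡⟨ cong₂ _+_ bar-length (cong₂ _+_ bar-length (length-map _ (filter (near? v) (allFin n)))) ⟩
    2 * n + (2 * n + length (filter (near? v) (allFin n)))
      -- The only estimate: the pegs are selected from the `n` vertices.
      ≤⟨ +-monoʳ-≤ (2 * n) (+-monoʳ-≤ (2 * n) (length-filter (near? v) (allFin n))) ⟩
    2 * n + (2 * n + length (allFin n))
      ≡⟨ cong (λ k → 2 * n + (2 * n + k)) (length-tabulate {n = n} _) ⟩
    2 * n + (2 * n + n)
      ≡⟨ collect n ⟩
    5 * n ∎
    where
    open ≤-Reasoning

    bar-length : ∀ {f : ℕ → Voxel} → length (map f (upTo (2 * n))) ≡ 2 * n
    bar-length = trans (length-map _ (upTo (2 * n))) (length-upTo (2 * n))

    collect : ∀ n → 2 * n + (2 * n + n) ≡ 5 * n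
    collect = solve-∀

  representation-size : size representation ≤ 5 * n ^ 2
  representation-size = begin
    size representation ≤⟨ sum-tabulate-≤ _ blob-size ⟩
    n * (5 * n)         ≡⟨ rearrange n ⟩
    5 * n ^ 2           ∎
    where
    open ≤-Reasoning

    -- The right-hand side is `5 * n ^ 2` with the power unfolded.
    rearrange : ∀ n → n * (5 * n) ≡ 5 * (n * (n * 1))
    rearrange = solve-∀

theorem9 : ∃[ C ] (C > 0 ×
    (∀ (n : ℕ) → n ≥ 1 → (G : Graph n) →
    Σ[ R ∈ VoxelRepresentation G ] (size R ≤ C * n ^ 2)))
theorem9 = 5 , s≤s z≤n , λ n _ G →
  let open Construction G in representation , representation-size
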